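{- Let $\mathcal{M}$ be an ultrahomogeneous $\mathcal{L}$-structure. Then the following are equivalent: (1) $\mathrm{Aut}(\mathcal{M})$ is extremely amenable. (2) $\mathrm{Age}(\mathcal{M})$ is a finitary Ramsey class.
   Context: $\mathcal{L}$ is a first-order language; structures need not be countable, relational or locally finite. $\mathcal{M}$ is ultrahomogeneous if every isomorphism between finitely generated substructures extends to an automorphism of $\mathcal{M}$. $\mathrm{Aut}(\mathcal{M})$ carries the topology of pointwise convergence ($M$ discrete); a topological group is extremely amenable if every continuous action of it on a nonempty compact Hausdorff space has a fixed point. $\mathrm{Age}(\mathcal{M})$ is the class of (isomorphism types of) finitely generated substructures of $\mathcal{M}$, treated as an isomorphism-closed class. For structures $M,N$, a finite subset $A\subseteq M$ and a subset $C\subseteq N$, $\binom{C}{A}$ denotes the set of copies of $A$ in $C$ with the same quantifier-free type, i.e. the set of maps $f:A\to C$ with $\mathrm{qftp}_N(f(\bar a))=\mathrm{qftp}_M(\bar a)$ for an enumeration $\bar a$ of $A$ (quantifier-free types are complete, over $\emptyset$, and computed in the ambient structure). Write $C\to(B)^A_2$ if for every $\chi:\binom{C}{A}\to\{0,1\}$ there is $e\in\binom{C}{B}$ such that $\chi$ is constant on the set of those $f\in\binom{C}{A}$ with image contained in $e(B)$. A class $\mathcal{C}$ of structures has the finitary embedding Ramsey property (f-ERP) if for every $M\in\mathcal{C}$ and all finite subsets $A,B\subseteq M$ there are $N\in\mathcal{C}$ and a finite subset $C\subseteq N$ with $C\to(B)^A_2$. It is a finitary Ramsey class if it has HP (closed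 under finitely generated substructures), JEP (any two members embed in a common member) and f-ERP. -}

module Defs where

open import Algebra.Bundles using (Group)
open import Data.Bool using (Bool)
open import Data.Empty.Polymorphic using (⊥)
open import Data.Fin using (Fin)
open import Data.List using (List)
open import Data.List.Relation.Unary.Any using (Any)
open import Data.Nat using (ℕ)
open import Data.Product using (Σ; ∃; ∃-syntax; _×_; _,_; proj₁; proj₂)
open import Data.Product.Relation.Binary.Pointwise.NonDependent using (_×ₛ_)
open import Data.Sum using (_⊎_)
open import Data.Unit.Polymorphic using (⊤; tt)
open import Data.Vec using (Vec; []; _∷_; lookup; map; _++_)
open import Data.Vec.Membership.Propositional using () renaming (_∈_ to _∈ᵥ_)
open import Data.Vec.Membership.Propositional.Properties
  using (∈-map⁺; ∈-++⁺ˡ; ∈-++⁺ʳ)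
open import Data.Vec.Properties using (map-∘; map-cong; map-id)
open import Data.Vec.Relation.Unary.All using (All; []; _∷_)
open import Function.Base using (_∘_; _on_)
open import Function.Bundles
  using (Func; Inverse; Injection; _↔_; _↣_; _⇔_)
open import Function.Construct.Composition using (_↔-∘_; _⇔-∘_)
open import Function.Construct.Identity using (↔-id; ⇔-id)
open import Function.Construct.Symmetry using (↔-sym; ⇔-sym)
open import Level using (Level; suc; Lift; lift; lower)
open import Relation.Binary.Bundles using (Setoid)
import Relation.Binary.Construct.On as On
open import Relation.Binary.PropositionalEquality as ≡
  using (_≡_; refl; sym; trans; cong; subst)
open import Relation.Nullary using (¬_)
open import Relation.Unary using (Pred; Irrelevant; _∈_; _⊆_; _≐_; _∩_; _⊢_; ⋃)

record Language (ℓ : Level) : Set (suc ℓ) where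
  field
    Function : ℕ → Set ℓ
    Relation : ℕ → Set ℓ

open Language public

record Structure {ℓ} (L : Language ℓ) : Set (suc ℓ) where
  field
    Carrier : Set ℓ
    fun     : ∀ {n} → Function L n → Vec Carrier n → Carrier
    rel     : ∀ {n} → Relation L n → Vec Carrier n → Set ℓ

open Structure public using (fun; rel)

∣_∣ : ∀ {ℓ} {L : Language ℓ} → Structure L → Set ℓ
∣ M ∣ = Structure.Carrier M

module _ {ℓ} {L : Language ℓ} where

  record Embedding (M N : Structure L) : Set ℓ where
    field
      injection : ∣ M ∣ ↣ ∣ N ∣
    open Injection injection public using (to; injective)
    field
      to-fun : ∀ {n} (f : Function L n) xs → to (fun M f xs) ≡ fun N f (map to xs)
      to-rel : ∀ {n} (R : Relation L n) xs → rel M R xs ⇔ rel N R (map to xs)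

  infix 4 _≅_

  record _≅_ (M N : Structure L) : Set ℓ where
    field
      bijection : ∣ M ∣ ↔ ∣ N ∣
    open Inverse bijection public
      using (to; from; strictlyInverseˡ; strictlyInverseʳ)
    field
      to-fun : ∀ {n} (f : Function L n) xs → to (fun M f xs) ≡ fun N f (map to xs)
      to-rel : ∀ {n} (R : Relation L n) xs → rel M R xs ⇔ rel N R (map to xs)

  -- Membership is required to be proof-irrelevant so that propositional
  -- equality on Σ ∣ M ∣ Member is equality in M.
  record Substructure (M : Structure L) : Set (suc ℓ) where
    field
      Member     : Pred ∣ M ∣ ℓ
      irrelevant : Irrelevant Member
      closed     : ∀ {n} (f : Function L n) {xs} → All Member xs → Member (fun M f xs)

  open Substructure public using (Member)

  all-proj₁ : ∀ {a p} {A : Set a} {P : Pred A p} {n} (xs : Vec (Σ A P) n) →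
              All P (map proj₁ xs)
  all-proj₁ []       = []
  all-proj₁ (x ∷ xs) = proj₂ x ∷ all-proj₁ xs

  ⟪_⟫ : {M : Structure L} → Substructure M → Structure L
  ⟪_⟫ {M} S = record
    { Carrier = Σ ∣ M ∣ (Member S)
    ; fun     = λ f xs → fun M f (map proj₁ xs) , Substructure.closed S f (all-proj₁ xs)
    ; rel     = λ R xs → rel M R (map proj₁ xs)
    }

data Term {ℓ} (L : Language ℓ) (n : ℕ) : Set ℓ where
  var : Fin n → Term L n
  app : ∀ {k} → Function L k → Vec (Term L n) k → Term L n

infix  6 _≐ₜ_
infixr 5 _∧ᶠ_
infixr 4 _∨ᶠ_

data QFFormula {ℓ} (L : Language ℓ) (n : ℕ) : Set ℓ where
  ⊤ᶠ ⊥ᶠ     : QFFormula L n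
  _≐ₜ_      : Term L n → Term L n → QFFormula L n
  atom      : ∀ {k} → Relation L k → Vec (Term L n) k → QFFormula L n
  ¬ᶠ_       : QFFormula L n → QFFormula L n
  _∧ᶠ_ _∨ᶠ_ : QFFormula L n → QFFormula L n → QFFormula L n

module _ {ℓ} {L : Language ℓ} where

  module _ (M : Structure L) {n} (a : Vec ∣ M ∣ n) where

    eval  : Term L n → ∣ M ∣
    evals : ∀ {k} → Vec (Term L n) k → Vec ∣ M ∣ k

    eval (var i)    = lookup a i
    eval (app f ts) = fun M f (evals ts)

    evals []       = []
    evals (t ∷ ts) = eval t ∷ evals ts

    Holds : QFFormula L n → Set ℓ
    Holds ⊤ᶠ          = ⊤
    Holds ⊥ᶠ          = ⊥
    Holds (s ≐ₜ t)    = eval s ≡ eval t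
    Holds (atom R ts) = rel M R (evals ts)
    Holds (¬ᶠ φ)      = ¬ Holds φ
    Holds (φ ∧ᶠ ψ)    = Holds φ × Holds ψ
    Holds (φ ∨ᶠ ψ)    = Holds φ ⊎ Holds ψ

    qftp : Pred (QFFormula L n) ℓ
    qftp = Holds

  FinitelyGenerated : {M : Structure L} → Substructure M → Set ℓ
  FinitelyGenerated {M} S =
    ∃[ n ] Σ (Vec ∣ M ∣ n) λ a →
      Member S ≐ (λ x → ∃[ t ] eval M a t ≡ x)

  Ultrahomogeneous : Structure L → Set (suc ℓ)
  Ultrahomogeneous M =
    (S T : Substructure M) → FinitelyGenerated S → FinitelyGenerated T →
    (φ : ⟪ S ⟫ ≅ ⟪ T ⟫) →
    Σ (M ≅ M) λ g → ∀ x → _≅_.to g (proj₁ x) ≡ proj₁ (_≅_.to φ x)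

  Age : Structure L → Pred (Structure L) (suc ℓ)
  Age M N = Σ (Substructure M) λ S → FinitelyGenerated S × N ≅ ⟪ S ⟫

  -- A finite subset is given by an enumeration (repetitions allowed), and a
  -- map f out of it by the tuple f(a) of its values.  Any tuple with the
  -- same quantifier-free type as a arises this way: formulas x_i = x_j make
  -- the induced map well defined (and injective).
  record Copy {M N : Structure L} {n} (A : Vec ∣ M ∣ n) (C : Pred ∣ N ∣ ℓ) : Set ℓ where
    field
      values : Vec ∣ N ∣ n
      inside : All C values
      sameQF : qftp N values ≐ qftp M A

    image : Pred ∣ N ∣ ℓ
    image x = x ∈ᵥ values

  open Copy public using (values; image)

  -- Copies are equal when they are equal as maps.
  copies : {M N : Structure L} {n : ℕ} → Vec ∣ M ∣ n → Pred ∣ N ∣ ℓ → Setoid ℓ ℓ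
  copies {M} {N} A C = record
    { Carrier       = Copy {M} {N} A C
    ; _≈_           = _≡_ on values
    ; isEquivalence = On.isEquivalence values ≡.isEquivalence
    }

  Arrow : {M N : Structure L} {m n : ℕ} →
          Pred ∣ N ∣ ℓ → Vec ∣ M ∣ m → Vec ∣ M ∣ n → Set ℓ
  Arrow {M} {N} C B A =
    (χ : Func (copies {M} {N} A C) (≡.setoid Bool)) →
    Σ (Copy {M} {N} B C) λ e →
    (f f′ : Copy {M} {N} A C) → image f ⊆ image e → image f′ ⊆ image e →
    Func.to χ f ≡ Func.to χ f′

  module _ {κ} (𝒞 : Pred (Structure L) κ) where

    HP : Set _
    HP = ∀ {M} → M ∈ 𝒞 → (S : Substructure M) → FinitelyGenerated S → ⟪ S ⟫ ∈ 𝒞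

    JEP : Set _
    JEP = ∀ {M N} → M ∈ 𝒞 → N ∈ 𝒞 →
          Σ (Structure L) λ K → K ∈ 𝒞 × Embedding M K × Embedding N K

    f-ERP : Set _
    f-ERP = ∀ {M} → M ∈ 𝒞 → ∀ {m n} (A : Vec ∣ M ∣ m) (B : Vec ∣ M ∣ n) →
            Σ (Structure L) λ N → N ∈ 𝒞 ×
            ∃[ k ] Σ (Vec ∣ N ∣ k) λ C → Arrow {M} {N} (_∈ᵥ C) B A

    FinitaryRamseyClass : Set _
    FinitaryRamseyClass = HP × JEP × f-ERP

-- The points of a space are the elements of a setoid up to its equality.
-- Subsets and index sets live in Set ℓ.  Classically this loses no subset
-- and no family of subsets: up to extensional equality, the subsets of X are
-- indexed by X → Bool.
record Topology {ℓ} (X : Setoid ℓ ℓ) : Set (suc (suc ℓ)) where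
  open Setoid X using (Carrier; _≈_)
  field
    Open      : Pred (Pred Carrier ℓ) (suc ℓ)
    Open-ext  : ∀ {U V} → U ≐ V → Open U → Open V
    Open-resp : ∀ {U} → Open U → ∀ {x y} → x ≈ y → x ∈ U → y ∈ U
    Open-⊤    : Open (λ _ → ⊤)
    Open-∩    : ∀ {U V} → Open U → Open V → Open (U ∩ V)
    Open-⋃    : {I : Set ℓ} (U : I → Pred Carrier ℓ) →
                (∀ i → Open (U i)) → Open (⋃ I U)

open Topology public using (Open)

module _ {ℓ} {X : Setoid ℓ ℓ} where
  open Setoid X using (Carrier; _≈_)

  Compact : Topology X → Set (suc ℓ)
  Compact τ = {I : Set ℓ} (U : I → Pred Carrier ℓ) → (∀ i → Open τ (U i)) →
              (∀ x → ∃[ i ] x ∈ U i) →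
              Σ (List I) λ is → ∀ x → Any (λ i → x ∈ U i) is

  Hausdorff : Topology X → Set (suc ℓ)
  Hausdorff τ = ∀ x y → ¬ (x ≈ y) →
                ∃[ U ] ∃[ V ] Open τ U × Open τ V × x ∈ U × y ∈ V ×
                (∀ z → ¬ (z ∈ U × z ∈ V))

Continuous : ∀ {ℓ} {X Y : Setoid ℓ ℓ} → Topology X → Topology Y → Func X Y → Set (suc ℓ)
Continuous σ τ f = ∀ {V} → Open τ V → Open σ (Func.to f ⊢ V)

infixr 2 _×ₜ_

_×ₜ_ : ∀ {ℓ} {X Y : Setoid ℓ ℓ} → Topology X → Topology Y → Topology (X ×ₛ Y)
_×ₜ_ {ℓ} {X} {Y} σ τ = record
  { Open      = λ W →
      (∀ {p q} → Setoid._≈_ (X ×ₛ Y) p q → p ∈ W → q ∈ W) ×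
      (∀ x y → (x , y) ∈ W →
        ∃[ U ] ∃[ V ] Open σ U × Open τ V × x ∈ U × y ∈ V ×
        (∀ x′ y′ → x′ ∈ U → y′ ∈ V → (x′ , y′) ∈ W))
  ; Open-ext  = λ { (to , from) (r , o) →
      (λ p≈q p∈ → to (r p≈q (from p∈))) ,
      (λ x y xy∈ → let U , V , oU , oV , x∈ , y∈ , s = o x y (from xy∈) in
        U , V , oU , oV , x∈ , y∈ , λ x′ y′ u v → to (s x′ y′ u v)) }
  ; Open-resp = λ o p≈q → proj₁ o p≈q
  ; Open-⊤    = (λ _ _ → tt) , λ _ _ _ →
      (λ _ → ⊤) , (λ _ → ⊤) , σ.Open-⊤ , τ.Open-⊤ , tt , tt , λ _ _ _ _ → tt
  ; Open-∩    = λ { (r₁ , o₁) (r₂ , o₂) →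
      (λ { p≈q (p∈₁ , p∈₂) → r₁ p≈q p∈₁ , r₂ p≈q p∈₂ }) ,
      λ { x y (m₁ , m₂) →
        let U₁ , V₁ , oU₁ , oV₁ , x∈₁ , y∈₁ , s₁ = o₁ x y m₁
            U₂ , V₂ , oU₂ , oV₂ , x∈₂ , y∈₂ , s₂ = o₂ x y m₂
        in U₁ ∩ U₂ , V₁ ∩ V₂ , σ.Open-∩ oU₁ oU₂ , τ.Open-∩ oV₁ oV₂ ,
           (x∈₁ , x∈₂) , (y∈₁ , y∈₂) ,
           λ { x′ y′ (u₁ , u₂) (v₁ , v₂) → s₁ x′ y′ u₁ v₁ , s₂ x′ y′ u₂ v₂ } } }
  ; Open-⋃    = λ W o →
      (λ { p≈q (i , p∈) → i , proj₁ (o i) p≈q p∈ }) ,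
      λ { x y (i , m) →
        let U , V , oU , oV , x∈ , y∈ , s = proj₂ (o i) x y m in
        U , V , oU , oV , x∈ , y∈ , λ x′ y′ u v → i , s x′ y′ u v }
  }
  where
    module σ = Topology σ
    module τ = Topology τ

record TopologicalGroup (ℓ : Level) : Set (suc (suc ℓ)) where
  field
    group : Group ℓ ℓ

  open Group group public

  ∙-func : Func (setoid ×ₛ setoid) setoid
  ∙-func = record
    { to   = λ p → proj₁ p ∙ proj₂ p
    ; cong = λ p≈q → ∙-cong (proj₁ p≈q) (proj₂ p≈q)
    }

  ⁻¹-func : Func setoid setoid
  ⁻¹-func = record { to = _⁻¹ ; cong = ⁻¹-cong }

  field
    topology      : Topology setoid
    ∙-continuous  : Continuous (topology ×ₜ topology) topology ∙-func
    ⁻¹-continuous : Continuous topology topology ⁻¹-func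

module _ {ℓ} (G : TopologicalGroup ℓ) where
  private module G = TopologicalGroup G

  record ContinuousAction {X : Setoid ℓ ℓ} (τ : Topology X) : Set (suc ℓ) where
    open Setoid X using (Carrier; _≈_)
    field
      act : Func (G.setoid ×ₛ X) X

    infixr 7 _·_
    _·_ : G.Carrier → Carrier → Carrier
    g · x = Func.to act (g , x)

    field
      identity   : ∀ x → G.ε · x ≈ x
      compatible : ∀ g h x → (g G.∙ h) · x ≈ g · h · x
      continuous : Continuous (G.topology ×ₜ τ) τ act

  ExtremelyAmenable : Set (suc (suc ℓ))
  ExtremelyAmenable =
    (X : Setoid ℓ ℓ) (τ : Topology X) → Setoid.Carrier X → Compact τ → Hausdorff τ →
    (α : ContinuousAction τ) → let open ContinuousAction α; open Setoid X in
    ∃[ x ] ∀ g → g · x ≈ x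

module _ {ℓ} {L : Language ℓ} where

  ≅-refl : {M : Structure L} → M ≅ M
  ≅-refl {M} = record
    { bijection = ↔-id ∣ M ∣
    ; to-fun    = λ f xs → cong (fun M f) (sym (map-id xs))
    ; to-rel    = λ R xs → subst (λ ys → rel M R xs ⇔ rel M R ys)
                             (sym (map-id xs)) (⇔-id (rel M R xs))
    }

  ≅-trans : {M N K : Structure L} → M ≅ N → N ≅ K → M ≅ K
  ≅-trans {M} {N} {K} g h = record
    { bijection = h.bijection ↔-∘ g.bijection
    ; to-fun    = λ f xs → trans (cong h.to (g.to-fun f xs))
                    (trans (h.to-fun f (map g.to xs))
                           (cong (fun K f) (sym (map-∘ h.to g.to xs))))
    ; to-rel    = λ R xs → subst (λ ys → rel M R xs ⇔ rel K R ys)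
                    (sym (map-∘ h.to g.to xs))
                    (h.to-rel R (map g.to xs) ⇔-∘ g.to-rel R xs)
    }
    where
      module g = _≅_ g
      module h = _≅_ h

  ≅-sym : {M N : Structure L} → M ≅ N → N ≅ M
  ≅-sym {M} {N} g = record
    { bijection = ↔-sym bijection
    ; to-fun    = λ f ys → trans
                    (cong (from ∘ fun N f) (sym (to-from ys)))
                    (trans (cong from (sym (to-fun f (map from ys))))
                           (strictlyInverseʳ (fun M f (map from ys))))
    ; to-rel    = λ R ys → subst (λ zs → rel N R zs ⇔ rel M R (map from ys))
                    (to-from ys) (⇔-sym (to-rel R (map from ys)))
    }
    where
      open _≅_ g
      to-from : ∀ {n} (ys : Vec ∣ N ∣ n) → map to (map from ys) ≡ ys
      to-from ys = trans (sym (map-∘ to from ys))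
                     (trans (map-cong strictlyInverseˡ ys) (map-id ys))

module _ {ℓ} {L : Language ℓ} (M : Structure L) where
  open _≅_

  autGroup : Group ℓ ℓ
  autGroup = record
    { Carrier = M ≅ M
    ; _≈_     = λ g h → ∀ x → to g x ≡ to h x
    ; _∙_     = λ g h → ≅-trans h g
    ; ε       = ≅-refl
    ; _⁻¹     = ≅-sym
    ; isGroup = record
      { isMonoid = record
        { isSemigroup = record
          { isMagma = record
            { isEquivalence = record
              { refl  = λ _ → refl
              ; sym   = λ p x → sym (p x)
              ; trans = λ p q x → trans (p x) (q x)
              }
            ; ∙-cong = λ {g} {g′} {h} {h′} p q x →
                trans (cong (to g) (q x)) (p (to h′ x))
            }
          ; assoc = λ _ _ _ _ → refl
          }
        ; identity = (λ _ _ → refl) , (λ _ _ → refl)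
        }
      ; inverse = (λ g → strictlyInverseʳ g) , (λ g → strictlyInverseˡ g)
      ; ⁻¹-cong = λ {g} {h} → inv-cong g h
      }
    }
    where
      inv-cong : (g h : M ≅ M) → (∀ x → to g x ≡ to h x) → ∀ x → from g x ≡ from h x
      inv-cong g h p x = trans (cong (from g) (sym (strictlyInverseˡ h x)))
                           (trans (cong (from g) (sym (p (from h x))))
                                  (strictlyInverseʳ g (from h x)))

  AgreeOn : ∀ {n} → Vec ∣ M ∣ n → (g h : M ≅ M) → Set ℓ
  AgreeOn a g h = ∀ {x} → x ∈ᵥ a → to g x ≡ to h x

  pointwiseTopology : Topology (Group.setoid autGroup)
  pointwiseTopology = record
    { Open      = λ U → Lift (suc ℓ)
        (∀ g → g ∈ U → ∃[ n ] Σ (Vec ∣ M ∣ n) λ a → ∀ h → AgreeOn a g h → h ∈ U)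
    ; Open-ext  = λ { (U⊆V , V⊆U) (lift o) → lift λ g g∈ →
        let n , a , p = o g (V⊆U g∈) in n , a , λ h q → U⊆V (p h q) }
    ; Open-resp = λ { (lift o) {g} {h} g≈h g∈ →
        let _ , _ , p = o g g∈ in p h (λ {x} _ → g≈h x) }
    ; Open-⊤    = lift λ _ _ → 0 , [] , λ _ _ → tt
    ; Open-∩    = λ { (lift o₁) (lift o₂) → lift λ { g (g∈₁ , g∈₂) →
        let _ , a₁ , p₁ = o₁ g g∈₁
            _ , a₂ , p₂ = o₂ g g∈₂
        in _ , a₁ ++ a₂ , λ h q →
             p₁ h (λ x∈ → q (∈-++⁺ˡ x∈)) , p₂ h (λ x∈ → q (∈-++⁺ʳ a₁ x∈)) } }
    ; Open-⋃    = λ U o → lift λ { g (i , g∈) →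
        let n , a , p = lower (o i) g g∈ in n , a , λ h q → i , p h q }
    }

  Aut : TopologicalGroup ℓ
  Aut = record
    { group         = autGroup
    ; topology      = pointwiseTopology
    ; ∙-continuous  = λ {U} oU →
        (λ { {g , h} {g′ , h′} (p , q) →
             Topology.Open-resp pointwiseTopology oU
               {≅-trans h g} {≅-trans h′ g′}
               (λ x → trans (cong (to g) (q x)) (p (to h′ x))) }) ,
        λ g h gh∈U → let n , a , s = lower oU (≅-trans h g) gh∈U in
          (λ g′ → AgreeOn (map (to h) a) g g′) , (λ h′ → AgreeOn a h h′) ,
          basic-open (map (to h) a) g , basic-open a h ,
          (λ _ → refl) , (λ _ → refl) ,
          λ g′ h′ p q → s (≅-trans h′ g′) λ {x} x∈ →
            trans (p (∈-map⁺ (to h) x∈)) (cong (to g′) (q x∈))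
    ; ⁻¹-continuous = λ {U} oU → lift λ g g∈ →
        let n , a , s = lower oU (≅-sym g) g∈ in
        n , map (from g) a , λ h p → s (≅-sym h) λ {x} x∈ →
          trans (sym (strictlyInverseʳ h (from g x)))
                (cong (from h) (trans (sym (p (∈-map⁺ (from g) x∈)))
                                      (strictlyInverseˡ g x)))
    }
    where
      basic-open : ∀ {n} (a : Vec ∣ M ∣ n) g → Open pointwiseTopology (AgreeOn a g)
      basic-open a g = lift λ h p → _ , a , λ k q x∈ → trans (p x∈) (q x∈)

{-# OPTIONS --safe #-}
module Submission where

open import Algebra.Bundles using (Group)
open import Axiom.ExcludedMiddle using (ExcludedMiddle)
open import Axiom.Extensionality.Propositional using (Extensionality)
open import Data.Bool using (Bool; true; false)
open import Data.Bool.Properties using (⇔→≡)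
open import Data.Empty using (⊥; ⊥-elim)
open import Data.Fin using (_↑ˡ_; _↑ʳ_)
open import Data.List.Base as List using (List; []; _∷_)
open import Data.List.Membership.Propositional using (_∈_; find; lose)
open import Data.List.Membership.Propositional.Properties as ∈ₗ using (∈-cartesianProductWith⁺)
open import Data.List.Relation.Binary.Subset.Propositional renaming (_⊆_ to _⊆ₗ_) using ()
open import Data.List.Relation.Unary.All as Allₗ using ([]; _∷_) renaming (All to Allₗ)
import Data.List.Relation.Unary.All.Properties as Allₗ
open import Data.List.Relation.Unary.Any using (here; there)
open import Data.Nat using (ℕ; zero; suc)
open import Data.Product using (Σ; ∃; ∃-syntax; _×_; _,_; proj₁; proj₂)
open import Data.Sum as Sum using (_⊎_; inj₁; inj₂; [_,_])
open import Data.Vec using (Vec; []; _∷_; lookup; map; _++_; tabulate; fromList; toList)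
open import Data.Vec.Membership.Propositional using () renaming (_∈_ to _∈ᵥ_)
open import Data.Vec.Membership.Propositional.Properties
  using (∈-map⁺; ∈-lookup; ∈-fromList⁺; ∈-toList⁺)
open import Data.Vec.Properties
  using (∷-injectiveˡ; ∷-injectiveʳ; map-∘; map-cong; map-id; lookup-map; lookup-++ˡ; lookup-++ʳ;
         tabulate-∘; tabulate∘lookup; tabulate-cong)
open import Data.Vec.Relation.Unary.All as All using (All; []; _∷_)
open import Data.Vec.Relation.Unary.All.Properties using (lookup⁻; gmap)
open import Data.Vec.Relation.Unary.Any using (here; there)
open import Function.Base using (_∘_; id; const)
open import Function.Bundles using (Func; Inverse; Equivalence; _⇔_; mk⇔; mk↣; mk↔ₛ′)
open import Function.Construct.Composition using (_⇔-∘_)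
open import Function.Construct.Identity using (⇔-id)
open import Function.Properties.Inverse using (↔⇒↣) renaming (sym to inverse)
open import Level using (Lift; lift; lower)
open import Relation.Binary.Bundles using (Setoid)
open import Relation.Binary.PropositionalEquality as ≡
  using (_≡_; refl; sym; trans; cong; cong₂; subst)
open import Relation.Nullary using (¬_; yes; no; does)
open import Relation.Nullary.Decidable using (dec-true; decidable-stable)
open import Relation.Unary using (Pred; _⊆_; _≐_; _∩_)
open import Relation.Unary.Properties using (≐-refl; ≐-sym; ≐-trans)
open import Defs

-- Both sides are equivalent to a Ramsey property of tuples of M itself (RamseyIn).
--
-- Given it, let Aut M act on a compact Hausdorff X without a fixed point.  Then
-- X is covered by finitely many open sets W with g W ∩ W = ∅, shrunk to sets V
-- which the stabiliser of a tuple a moves only inside W.  Colour the copies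
-- k a of a by whether k⁻¹ x₀ ∈ V.  For h making all these colourings constant on
-- the tuples h a and h g⁻¹ a, the point y = h⁻¹ x₀ lies in some V, so that both
-- y and g y lie in W.
--
-- Conversely, if the Ramsey property fails for A and B, then by compactness of
-- the cube 2^(Mᵐ) some colouring of M is constant on the copies of A inside no
-- copy of B.  Such colourings form a nonempty compact Hausdorff Aut M-space, but
-- a fixed one is constant on all copies of A, by ultrahomogeneity.

-- Vectors and lists of tuples.

lookup-injective : ∀ {a} {A : Set a} {n} {xs ys : Vec A n} →
                   (∀ i → lookup xs i ≡ lookup ys i) → xs ≡ ys
lookup-injective {xs = xs} {ys} p =
  trans (sym (tabulate∘lookup xs)) (trans (tabulate-cong p) (tabulate∘lookup ys))

map-injective : ∀ {a b} {A : Set a} {B : Set b} {f : A → B} → (∀ {x y} → f x ≡ f y → x ≡ y) →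
                ∀ {n} (xs ys : Vec A n) → map f xs ≡ map f ys → xs ≡ ys
map-injective inj []       []       _  = refl
map-injective inj (x ∷ xs) (y ∷ ys) eq =
  cong₂ _∷_ (inj (∷-injectiveˡ eq)) (map-injective inj xs ys (∷-injectiveʳ eq))

∈-map⁻ : ∀ {a b} {A : Set a} {B : Set b} {f : A → B} {n y} (xs : Vec A n) →
         y ∈ᵥ map f xs → ∃[ x ] f x ≡ y × x ∈ᵥ xs
∈-map⁻ (x ∷ xs) (here refl) = x , refl , here refl
∈-map⁻ (x ∷ xs) (there i)   = let z , p , q = ∈-map⁻ xs i in z , p , there q

map-≡⇒≡ : ∀ {a b} {A : Set a} {B : Set b} {f g : A → B} {n x} (xs : Vec A n) →
          map f xs ≡ map g xs → x ∈ᵥ xs → f x ≡ g x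
map-≡⇒≡ (x ∷ xs) eq (here refl) = ∷-injectiveˡ eq
map-≡⇒≡ (x ∷ xs) eq (there i)   = map-≡⇒≡ xs (∷-injectiveʳ eq) i

map-cong-∈ : ∀ {a b} {A : Set a} {B : Set b} {f g : A → B} {n} (xs : Vec A n) →
             (∀ {x} → x ∈ᵥ xs → f x ≡ g x) → map f xs ≡ map g xs
map-cong-∈ []       p = refl
map-cong-∈ (x ∷ xs) p = cong₂ _∷_ (p (here refl)) (map-cong-∈ xs (p ∘ there))

tuplesOver : ∀ {a} {A : Set a} → List A → ∀ m → List (Vec A m)
tuplesOver xs zero    = [] ∷ []
tuplesOver xs (suc m) = List.cartesianProductWith _∷_ xs (tuplesOver xs m)

∈-tuplesOver : ∀ {a} {A : Set a} {xs : List A} {m} (v : Vec A m) →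
               (∀ {x} → x ∈ᵥ v → x ∈ xs) → v ∈ tuplesOver xs m
∈-tuplesOver []      sub = here refl
∈-tuplesOver (x ∷ v) sub =
  ∈-cartesianProductWith⁺ _∷_ (sub (here refl)) (∈-tuplesOver v (sub ∘ there))

-- Embeddings, quantifier-free types and finite generation.

module _ {ℓ} {L : Language ℓ} where

  module _ {M N : Structure L} (e : Embedding M N) where
    open Embedding e

    eval-map  : ∀ {n} (a : Vec ∣ M ∣ n) t → to (eval M a t) ≡ eval N (map to a) t
    evals-map : ∀ {n k} (a : Vec ∣ M ∣ n) (ts : Vec (Term L n) k) →
                map to (evals M a ts) ≡ evals N (map to a) ts
    eval-map a (var i)    = sym (lookup-map i to a)
    eval-map a (app f ts) = trans (to-fun f _) (cong (fun N f) (evals-map a ts))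
    evals-map a []       = refl
    evals-map a (t ∷ ts) = cong₂ _∷_ (eval-map a t) (evals-map a ts)

    -- Injectivity reflects equations and `to-rel` reflects relations. Both implications run in one
    -- induction because negation exchanges them.
    qftp-map : ∀ {n} (a : Vec ∣ M ∣ n) → qftp N (map to a) ≐ qftp M a
    qftp-map {n} a = (λ {φ} → proj₂ (both φ)) , (λ {φ} → proj₁ (both φ))
      where
      both : ∀ φ → (Holds M a φ → Holds N (map to a) φ) × (Holds N (map to a) φ → Holds M a φ)
      both ⊤ᶠ          = id , id
      both ⊥ᶠ          = (λ ()) , (λ ())
      both (s ≐ₜ t)    =
        (λ p → trans (sym (eval-map a s)) (trans (cong to p) (eval-map a t))) ,
        (λ p → injective (trans (eval-map a s) (trans p (sym (eval-map a t)))))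
      both (atom R ts) =
        (λ p → subst (rel N R) (evals-map a ts) (Equivalence.to (to-rel R _) p)) ,
        (λ p → Equivalence.from (to-rel R _) (subst (rel N R) (sym (evals-map a ts)) p))
      both (¬ᶠ φ)      = (λ p → p ∘ proj₂ (both φ)) , (λ p → p ∘ proj₁ (both φ))
      both (φ ∧ᶠ ψ)    =
        (λ { (p , q) → proj₁ (both φ) p , proj₁ (both ψ) q }) ,
        (λ { (p , q) → proj₂ (both φ) p , proj₂ (both ψ) q })
      both (φ ∨ᶠ ψ)    =
        Sum.map (proj₁ (both φ)) (proj₁ (both ψ)) ,
        Sum.map (proj₂ (both φ)) (proj₂ (both ψ))

  infixr 9 _∘ₑ_
  _∘ₑ_ : {M N K : Structure L} → Embedding N K → Embedding M N → Embedding M K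
  _∘ₑ_ {M} {N} {K} e d = record
    { injection = mk↣ (d.injective ∘ e.injective)
    ; to-fun    = λ f xs → trans (cong e.to (d.to-fun f xs))
                    (trans (e.to-fun f (map d.to xs)) (cong (fun K f) (sym (map-∘ e.to d.to xs))))
    ; to-rel    = λ R xs → subst (λ ys → rel M R xs ⇔ rel K R ys) (sym (map-∘ e.to d.to xs))
                    (e.to-rel R (map d.to xs) ⇔-∘ d.to-rel R xs)
    }
    where
    module e = Embedding e
    module d = Embedding d

  ≅⇒embedding : {M N : Structure L} → M ≅ N → Embedding M N
  ≅⇒embedding g = record
    { injection = ↔⇒↣ (_≅_.bijection g) ; to-fun = _≅_.to-fun g ; to-rel = _≅_.to-rel g }

  member-≡ : {M : Structure L} (S : Substructure M) {x y : ∣ ⟪ S ⟫ ∣} → proj₁ x ≡ proj₁ y → x ≡ y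
  member-≡ S {_ , p} {_ , q} refl = cong (_ ,_) (Substructure.irrelevant S p q)

  inclusion : {M : Structure L} (S : Substructure M) → Embedding ⟪ S ⟫ M
  inclusion S = record
    { injection = mk↣ (member-≡ S)
    ; to-fun    = λ _ _ → refl
    ; to-rel    = λ R xs → ⇔-id _
    }

  restrict : {M N : Structure L} (e : Embedding N M) (S : Substructure M) →
             (∀ x → Member S (Embedding.to e x)) → Embedding N ⟪ S ⟫
  restrict {M} {N} e S inS = record
    { injection = mk↣ (λ eq → injective (cong proj₁ eq))
    ; to-fun    = λ f xs → member-≡ S (trans (to-fun f xs) (cong (fun M f) (map-∘ proj₁ inS′ xs)))
    ; to-rel    = λ R xs → subst (λ ys → rel N R xs ⇔ rel M R ys) (map-∘ proj₁ inS′ xs)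
                    (to-rel R xs)
    }
    where
    open Embedding e
    inS′ = λ x → to x , inS x

  eval-member : {M : Structure L} (S : Substructure M) {n : ℕ} (a : Vec ∣ M ∣ n) →
                (∀ i → Member S (lookup a i)) → ∀ t → Member S (eval M a t)
  evals-member : {M : Structure L} (S : Substructure M) {n k : ℕ} (a : Vec ∣ M ∣ n) →
                 (∀ i → Member S (lookup a i)) →
                 (ts : Vec (Term L n) k) → All (Member S) (evals M a ts)
  eval-member S a a∈ (var i)    = a∈ i
  eval-member S a a∈ (app f ts) = Substructure.closed S f (evals-member S a a∈ ts)
  evals-member S a a∈ []       = []
  evals-member S a a∈ (t ∷ ts) = eval-member S a a∈ t ∷ evals-member S a a∈ ts

  lift-members : {M : Structure L} (S : Substructure M) {n : ℕ} (a : Vec ∣ M ∣ n) →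
                 (∀ i → Member S (lookup a i)) →
                 ∃[ b ] map (Embedding.to (inclusion S)) b ≡ a
  lift-members S a a∈ =
    tabulate (λ i → lookup a i , a∈ i) ,
    trans (sym (tabulate-∘ proj₁ _)) (tabulate∘lookup a)

  -- Finite generation without an ambient structure, so that it can be carried along embeddings.
  Generated : Structure L → Set ℓ
  Generated N = ∃[ n ] Σ (Vec ∣ N ∣ n) λ b → ∀ x → ∃[ t ] eval N b t ≡ x

  -- Each generator of `S` lies in `S` as the value of a variable, so it has a preimage; injectivity
  -- of `e` pulls the term equations back.
  generated : {M N : Structure L} (e : Embedding N M) (S : Substructure M) →
              FinitelyGenerated S → (∀ x → Member S (Embedding.to e x)) →
              (∀ {y} → Member S y → ∃[ x ] Embedding.to e x ≡ y) → Generated N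
  generated {M} {N} e S (n , a , S⊆ , ⊆S) inS onto = n , b , λ x →
    let t , eq = S⊆ (inS x) in
    t , injective (trans (eval-map e b t) (trans (cong (λ v → eval M v t) map-b) eq))
    where
    open Embedding e
    preimage : ∀ i → ∃[ x ] to x ≡ lookup a i
    preimage i = onto (⊆S (var i , refl))
    b = tabulate (proj₁ ∘ preimage)
    map-b : map to b ≡ a
    map-b = trans (sym (tabulate-∘ to _))
              (trans (tabulate-cong (proj₂ ∘ preimage)) (tabulate∘lookup a))

  age-embeds : {M N : Structure L} → Age M N → Embedding N M × Generated N
  age-embeds {M} (S , fg , iso) = e , generated e S fg (proj₂ ∘ _≅_.to iso)
    λ y∈S → _≅_.from iso (_ , y∈S) , cong proj₁ (_≅_.strictlyInverseˡ iso _)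
    where e = inclusion S ∘ₑ ≅⇒embedding iso

  -- Transfer of Ramsey arrows along embeddings.

  copyBijection : {M N K : Structure L} {n : ℕ} (e : Embedding N K) (A : Vec ∣ M ∣ n)
                  (A′ : Vec ∣ K ∣ n) → qftp K A′ ≐ qftp M A →
                  ∀ {k} (C : Vec ∣ N ∣ k) →
                  Inverse (copies {M = M} {N} A (_∈ᵥ C))
                          (copies {M = K} {K} A′ (_∈ᵥ map (Embedding.to e) C))
  copyBijection {M} {N} {K} {n} e A A′ A′≐A C = record
    { to        = push
    ; from      = pull
    ; to-cong   = cong (map to)
    ; from-cong = λ {f} {f′} eq → map-inj
        (trans (proj₁ (proj₂ (preimages (Copy.inside f))))
          (trans eq (sym (proj₁ (proj₂ (preimages (Copy.inside f′)))))))
    ; inverse   =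
        (λ {f} {f′} eq → trans (cong (map to) eq) (proj₁ (proj₂ (preimages (Copy.inside f))))) ,
        (λ {f} {f′} eq → map-inj (trans (proj₁ (proj₂ (preimages (Copy.inside f′)))) eq))
    }
    where
    open Embedding e
    map-inj : {xs ys : Vec ∣ N ∣ n} → map to xs ≡ map to ys → xs ≡ ys
    map-inj = map-injective injective _ _

    -- An embedding keeps quantifier-free types, so a tuple from `C` is a copy exactly when its
    -- image is.
    push : Copy {M = M} {N} A (_∈ᵥ C) → Copy {M = K} {K} A′ (_∈ᵥ map to C)
    push f = record
      { values = map to (values f)
      ; inside = gmap (∈-map⁺ to) (Copy.inside f)
      ; sameQF = ≐-trans (qftp-map e (values f)) (≐-trans (Copy.sameQF f) (≐-sym A′≐A))
      }

    preimages : ∀ {j} {ys : Vec ∣ K ∣ j} → All (_∈ᵥ map to C) ys →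
                ∃[ xs ] map to xs ≡ ys × All (_∈ᵥ C) xs
    preimages []       = [] , refl , []
    preimages (p ∷ ps) = let x , p₁ , p₂ = ∈-map⁻ C p ; xs , q₁ , q₂ = preimages ps in
      x ∷ xs , cong₂ _∷_ p₁ q₁ , p₂ ∷ q₂

    pull : Copy {M = K} {K} A′ (_∈ᵥ map to C) → Copy {M = M} {N} A (_∈ᵥ C)
    pull f = let xs , eq , xs∈ = preimages (Copy.inside f) in record
      { values = xs
      ; inside = xs∈
      ; sameQF = ≐-trans (≐-sym (qftp-map e xs))
                   (≐-trans (subst (λ v → qftp K v ≐ qftp K (values f)) (sym eq) ≐-refl)
                     (≐-trans (Copy.sameQF f) A′≐A))
      }

  -- The colouring is pulled back along `iA` and the resulting copy of `B` is pushed along `iB`. The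
  -- inclusion hypothesis takes copies inside the pushed copy back to copies inside the original
  -- one.
  arrow-transfer :
    {M N M′ N′ : Structure L} {m n : ℕ}
    {A : Vec ∣ M ∣ m} {B : Vec ∣ M ∣ n} {C : Pred ∣ N ∣ ℓ}
    {A′ : Vec ∣ M′ ∣ m} {B′ : Vec ∣ M′ ∣ n} {C′ : Pred ∣ N′ ∣ ℓ}
    (iA : Inverse (copies {M = M} {N} A C) (copies {M = M′} {N′} A′ C′))
    (iB : Inverse (copies {M = M} {N} B C) (copies {M = M′} {N′} B′ C′)) →
    (∀ f′ e → image f′ ⊆ image (Inverse.to iB e) → image (Inverse.from iA f′) ⊆ image e) →
    Arrow {M = M} {N} C B A → Arrow {M = M′} {N′} C′ B′ A′
  arrow-transfer {N = N} {A = A} iA iB reflects arrow χ′ = iB.to e , λ f f′ f⊆ f′⊆ →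
    trans (back f) (trans (mono (iA.from f) (iA.from f′) (reflects f e f⊆) (reflects f′ e f′⊆))
                          (sym (back f′)))
    where
    module iA = Inverse iA
    module iB = Inverse iB
    χ = record { to   = Func.to χ′ ∘ iA.to
               ; cong = λ {x} {y} eq → Func.cong χ′ (iA.to-cong {x} {y} eq) }
    e = proj₁ (arrow χ)
    mono = proj₂ (arrow χ)
    back : ∀ f → Func.to χ′ f ≡ Func.to χ′ (iA.to (iA.from f))
    back f = sym (Func.cong χ′ (iA.strictlyInverseˡ f))

  module _ {M N K : Structure L} (e : Embedding N K) {m n k : ℕ}
           (A : Vec ∣ M ∣ m) (B : Vec ∣ M ∣ n) (C : Vec ∣ N ∣ k)
           (A′ : Vec ∣ K ∣ m) (B′ : Vec ∣ K ∣ n)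
           (A′≐A : qftp K A′ ≐ qftp M A) (B′≐B : qftp K B′ ≐ qftp M B) where
    private
      iA = copyBijection e A A′ A′≐A C
      iB = copyBijection e B B′ B′≐B C
      open Embedding e using (to; injective)

    ∈-map-injective : ∀ {j} {x} {xs : Vec ∣ N ∣ j} → to x ∈ᵥ map to xs → x ∈ᵥ xs
    ∈-map-injective {xs = xs} i with _ , eq , x∈ ← ∈-map⁻ {f = to} xs i =
      subst (_∈ᵥ xs) (injective eq) x∈

    arrow-push : Arrow {M = M} {N} (_∈ᵥ C) B A → Arrow {M = K} {K} (_∈ᵥ map to C) B′ A′
    arrow-push = arrow-transfer iA iB λ f′ e f′⊆ {x} x∈ → ∈-map-injective
      (f′⊆ (subst (to x ∈ᵥ_) (Inverse.strictlyInverseˡ iA f′) (∈-map⁺ to x∈)))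

    arrow-pull : Arrow {M = K} {K} (_∈ᵥ map to C) B′ A′ → Arrow {M = M} {N} (_∈ᵥ C) B A
    arrow-pull = arrow-transfer (inverse iA) (inverse iB) reflects
      where
      reflects : ∀ f e′ → image f ⊆ image (Inverse.from iB e′) → image (Inverse.to iA f) ⊆ image e′
      reflects f e′ f⊆ y∈ with x , refl , x∈ ← ∈-map⁻ {f = to} (values f) y∈ =
        subst (to x ∈ᵥ_) (Inverse.strictlyInverseˡ iB e′) (∈-map⁺ to (f⊆ x∈))

-- Colourings of tuples and the action of automorphisms.

module _ {ℓ} {L : Language ℓ} (M : Structure L) where

  -- Colourings are defined on all `m`-tuples, not only on copies of `A`, so that they form a full
  -- cube on which automorphisms act by precomposition.
  ConstantOn : ∀ {m n} → Vec ∣ M ∣ m → (Vec ∣ M ∣ m → Bool) → Vec ∣ M ∣ n → Set ℓ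
  ConstantOn A χ D = ∀ v v′ → qftp M v ≐ qftp M A → qftp M v′ ≐ qftp M A →
    (_∈ᵥ v) ⊆ (_∈ᵥ D) → (_∈ᵥ v′) ⊆ (_∈ᵥ D) → χ v ≡ χ v′

module _ {ℓ} {L : Language ℓ} {M : Structure L} where
  open _≅_ using (to; from; strictlyInverseˡ; strictlyInverseʳ)

  from-to-map : (g : M ≅ M) → ∀ {n} (xs : Vec ∣ M ∣ n) → map (from g) (map (to g) xs) ≡ xs
  from-to-map g xs = trans (sym (map-∘ (from g) (to g) xs))
                       (trans (map-cong (strictlyInverseʳ g) xs) (map-id xs))

  to-from-map : (g : M ≅ M) → ∀ {n} (xs : Vec ∣ M ∣ n) → map (to g) (map (from g) xs) ≡ xs
  to-from-map g = from-to-map (≅-sym g)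

  qftp-aut : (g : M ≅ M) → ∀ {n} (a : Vec ∣ M ∣ n) → qftp M (map (to g) a) ≐ qftp M a
  qftp-aut g = qftp-map (≅⇒embedding g)

  ∈-map-to⁻ : (g : M ≅ M) → ∀ {m n} (xs : Vec ∣ M ∣ m) {ys : Vec ∣ M ∣ n} →
              (_∈ᵥ xs) ⊆ (_∈ᵥ map (to g) ys) → (_∈ᵥ map (from g) xs) ⊆ (_∈ᵥ ys)
  ∈-map-to⁻ g xs {ys} sub {x} x∈ with z , refl , z∈ ← ∈-map⁻ {f = from g} xs x∈ =
    subst (_ ∈ᵥ_) (from-to-map g ys) (∈-map⁺ (from g) (sub z∈))

-- Classical reasoning.

module Classical (em : ∀ {a} → ExcludedMiddle a) (ext : ∀ {a b} → Extensionality a b) where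

  ⌊_⌋ : ∀ {p} → Set p → Bool
  ⌊ P ⌋ = does (em {P = P})

  ⌊⌋⁺ : ∀ {p} {P : Set p} → P → ⌊ P ⌋ ≡ true
  ⌊⌋⁺ = dec-true em

  ⌊⌋⁻ : ∀ {p} {P : Set p} → ⌊ P ⌋ ≡ true → P
  ⌊⌋⁻ {P = P} eq with em {P = P}
  ... | yes p = p
  ... | no _ with () ← eq

  ¬¬-elim : ∀ {p} {P : Set p} → ¬ ¬ P → P
  ¬¬-elim = decidable-stable em

  ¬∀⟶∃¬ : ∀ {a p} {A : Set a} {P : A → Set p} → ¬ (∀ x → P x) → ∃[ x ] ¬ P x
  ¬∀⟶∃¬ ¬all = ¬¬-elim λ none → ¬all λ x → ¬¬-elim λ ¬px → none (x , ¬px)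

  -- Transfinite iteration and maximal consistent sets.

  module _ {ℓ} {W : Set ℓ} where

    infix 4 _∈ˢ_ _⊆ˢ_

    -- Subsets are `Bool`-valued so that they and their families stay in the universe of `W`, and
    -- extensionality makes subsets with the same elements equal.
    _∈ˢ_ : W → (W → Bool) → Set
    w ∈ˢ S = S w ≡ true

    _⊆ˢ_ : (S S′ : W → Bool) → Set ℓ
    S ⊆ˢ S′ = ∀ {w} → w ∈ˢ S → w ∈ˢ S′

    ⊆ˢ-antisym : ∀ {S S′} → S ⊆ˢ S′ → S′ ⊆ˢ S → S ≡ S′
    ⊆ˢ-antisym p q = ext λ w → ⇔→≡ (mk⇔ (p {w}) (q {w}))

    ⋃ˢ : ((W → Bool) → Bool) → W → Bool
    ⋃ˢ F w = ⌊ (∃[ S ] F S ≡ true × w ∈ˢ S) ⌋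

    ⊆-⋃ˢ : ∀ {F S} → F S ≡ true → S ⊆ˢ ⋃ˢ F
    ⊆-⋃ˢ S∈F w∈S = ⌊⌋⁺ (_ , S∈F , w∈S)

    ⋃ˢ-⊆ : ∀ {F S′} → (∀ {S} → F S ≡ true → S ⊆ˢ S′) → ⋃ˢ F ⊆ˢ S′
    ⋃ˢ-⊆ p w∈ with _ , S∈F , w∈S ← ⌊⌋⁻ w∈ = p S∈F w∈S

    -- The transfinite iterates of next, starting from ∅ = ⋃ ∅.
    data Tower (next : (W → Bool) → W → Bool) : (W → Bool) → Set ℓ where
      step  : ∀ {S} → Tower next S → Tower next (next S)
      union : ∀ F → (∀ {S} → F S ≡ true → Tower next S) → Tower next (⋃ˢ F)

    module _ {next : (W → Bool) → W → Bool} (inflationary : ∀ S → S ⊆ˢ next S) where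

      -- As in the Bourbaki–Witt theorem, the iterates form a chain because all
      -- of them are extreme.
      Extreme : (W → Bool) → Set ℓ
      Extreme S = ∀ {S′} → Tower next S′ → S′ ⊆ˢ S → S ⊆ˢ S′ ⊎ next S′ ⊆ˢ S

      -- `next` need not be monotone; mutual inclusion is first turned into equality.
      next-cong : ∀ {S S′} → S ⊆ˢ S′ → S′ ⊆ˢ S → next S ⊆ˢ next S′
      next-cong p q {w} = subst (λ X → w ∈ˢ next X) (⊆ˢ-antisym p q)

      -- Induction on the tower of `S′`. Extremeness handles the successor of an `X` below `S`:
      -- either `X` equals `S`, or `next X` is still below `S`.
      extreme-compare : ∀ {S} → Extreme S → ∀ {S′} → Tower next S′ →
                        S′ ⊆ˢ S ⊎ next S ⊆ˢ S′
      extreme-compare {S} ex {S′} (union F towers)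
        with em {P = ∃[ X ] F X ≡ true × next S ⊆ˢ X}
      ... | yes (X , X∈F , p) = inj₂ (⊆-⋃ˢ X∈F ∘ p)
      ... | no none = inj₁ (⋃ˢ-⊆ λ {X} X∈F → below X∈F (extreme-compare ex (towers X∈F)))
        where
        below : ∀ {X} → F X ≡ true → X ⊆ˢ S ⊎ next S ⊆ˢ X → X ⊆ˢ S
        below X∈F (inj₁ p) = p
        below X∈F (inj₂ p) = ⊥-elim (none (_ , X∈F , p))
      extreme-compare ex (step {X} t) with extreme-compare ex t
      ... | inj₂ p = inj₂ (inflationary X ∘ p)
      ... | inj₁ p with ex t p
      ...   | inj₁ q = inj₂ (next-cong q p)
      ...   | inj₂ q = inj₁ q

      -- Induction on `S`, comparing `S′` with earlier iterates. In a union, a member not below `S′`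
      -- has to lie above `next S′`.
      extreme : ∀ {S} → Tower next S → Extreme S
      extreme (step {S} t) t′ S′⊆ with extreme-compare (extreme t) t′
      ... | inj₂ p = inj₁ p
      ... | inj₁ p with extreme t t′ p
      ...   | inj₁ q = inj₂ (next-cong p q)
      ...   | inj₂ q = inj₂ (inflationary S ∘ q)
      extreme (union F towers) {S′} t′ S′⊆
        with em {P = ∃[ X ] F X ≡ true × ¬ X ⊆ˢ S′}
      ... | no none = inj₁ (⋃ˢ-⊆ λ X∈F → ¬¬-elim λ ¬p → none (_ , X∈F , ¬p))
      ... | yes (X , X∈F , ¬X⊆) with extreme-compare (extreme (towers X∈F)) t′
      ...   | inj₂ p = ⊥-elim (¬X⊆ (p ∘ inflationary X))
      ...   | inj₁ p with extreme (towers X∈F) t′ p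
      ...     | inj₁ q = ⊥-elim (¬X⊆ q)
      ...     | inj₂ q = inj₂ (⊆-⋃ˢ X∈F ∘ q)

      tower-total : ∀ {S S′} → Tower next S → Tower next S′ → S ⊆ˢ S′ ⊎ S′ ⊆ˢ S
      tower-total {S} t t′ with extreme-compare (extreme t) t′
      ... | inj₁ p = inj₂ p
      ... | inj₂ p = inj₁ (p ∘ inflationary S)

    -- The Teichmüller–Tukey lemma for the property of finite character "all
    -- finite subsets satisfy Q".
    module _ (Q : List W → Set ℓ)
             (Q-anti : ∀ {xs ys} → xs ⊆ₗ ys → Q ys → Q xs) (Q-[] : Q []) where

      Consistent : (W → Bool) → Set ℓ
      Consistent S = ∀ ws → Allₗ (_∈ˢ S) ws → Q ws

      CanAdd : W → (W → Bool) → Set ℓ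
      CanAdd w S = ¬ (w ∈ˢ S) × (∀ ws → Allₗ (_∈ˢ S) ws → Q (w ∷ ws))

      insert : W → (W → Bool) → W → Bool
      insert w S x = ⌊ (x ≡ w ⊎ x ∈ˢ S) ⌋

      insert-list : ∀ {w S ws} → Allₗ (_∈ˢ insert w S) ws →
                    ∃[ ws′ ] Allₗ (_∈ˢ S) ws′ × ws ⊆ₗ w ∷ ws′
      insert-list [] = [] , [] , λ ()
      insert-list {w} (x∈ ∷ ws∈) with ⌊⌋⁻ x∈ | insert-list ws∈
      ... | inj₁ refl | ws′ , p , q = ws′ , p , λ { (here refl) → here refl ; (there i) → q i }
      ... | inj₂ x∈S  | ws′ , p , q = _ ∷ ws′ , x∈S ∷ p , λ
        { (here refl) → there (here refl)
        ; (there i)   → weaken (q i) }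
        where
        weaken : ∀ {y x} → y ∈ w ∷ ws′ → y ∈ w ∷ x ∷ ws′
        weaken (here e)  = here e
        weaken (there i) = there (there i)

      -- Excluded middle at a Σ-type yields a witness, so it also makes the choice of the element to
      -- add.
      grow : (W → Bool) → W → Bool
      grow S with em {P = ∃[ w ] CanAdd w S}
      ... | yes (w , _) = insert w S
      ... | no _        = S

      grow-inflationary : ∀ S → S ⊆ˢ grow S
      grow-inflationary S x∈S with em {P = ∃[ w ] CanAdd w S}
      ... | yes _ = ⌊⌋⁺ (inj₂ x∈S)
      ... | no _  = x∈S

      grow-consistent : ∀ {S} → Consistent S → Consistent (grow S)
      grow-consistent {S} con ws ws∈ with em {P = ∃[ w ] CanAdd w S}
      ... | no _ = con ws ws∈
      ... | yes (w , _ , ok) with ws′ , p , q ← insert-list ws∈ = Q-anti q (ok ws′ p)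

      grow-stable : ∀ {S} → grow S ⊆ˢ S → ¬ (∃[ w ] CanAdd w S)
      grow-stable {S} p add with em {P = ∃[ w ] CanAdd w S}
      ... | yes (w , w∉S , _) = w∉S (p (⌊⌋⁺ (inj₁ refl)))
      ... | no none           = none add

      -- Iterates form a chain, so a nonempty finite list in a union already lies in one member. The
      -- empty list is split off because the family may be empty.
      tower-consistent : ∀ {S} → Tower grow S → Consistent S
      tower-consistent (step t) = grow-consistent (tower-consistent t)
      tower-consistent (union F towers) ws ws∈ with em {P = ws ≡ []}
      ... | yes refl = Q-[]
      ... | no ws≢[] = case-single (single ws ws∈)
        where
        single : ∀ ws → Allₗ (_∈ˢ ⋃ˢ F) ws →
                 ws ≡ [] ⊎ ∃[ S ] F S ≡ true × Allₗ (_∈ˢ S) ws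
        single []       []        = inj₁ refl
        single (w ∷ ws) (w∈ ∷ ws∈) with ⌊⌋⁻ w∈ | single ws ws∈
        ... | S , S∈F , w∈S | inj₁ refl = inj₂ (S , S∈F , w∈S ∷ [])
        ... | S , S∈F , w∈S | inj₂ (S′ , S′∈F , ws∈S′)
          with tower-total grow-inflationary (towers S∈F) (towers S′∈F)
        ...   | inj₁ p = inj₂ (S′ , S′∈F , p w∈S ∷ ws∈S′)
        ...   | inj₂ p = inj₂ (S , S∈F , w∈S ∷ Allₗ.map p ws∈S′)

        case-single : ws ≡ [] ⊎ (∃[ S ] F S ≡ true × Allₗ (_∈ˢ S) ws) → Q ws
        case-single (inj₁ e)              = ⊥-elim (ws≢[] e)
        case-single (inj₂ (S , S∈F , p)) = tower-consistent (towers S∈F) ws p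

      -- The union of all iterates is itself an iterate, so `grow` adds nothing to it and every
      -- missing element is refuted by a finite part.
      maximal-consistent : ∃[ S ] Consistent S ×
        (∀ w → ¬ (w ∈ˢ S) → ∃[ ws ] Allₗ (_∈ˢ S) ws × ¬ Q (w ∷ ws))
      maximal-consistent = top , tower-consistent top-tower , λ w w∉ → ¬¬-elim λ none →
        grow-stable (⊆-⋃ˢ (⌊⌋⁺ (step top-tower)))
          (w , w∉ , λ ws ws∈ → ¬¬-elim λ ¬q → none (ws , ws∈ , ¬q))
        where
        top : W → Bool
        top = ⋃ˢ (λ S → ⌊ Tower grow S ⌋)
        top-tower : Tower grow top
        top-tower = union _ ⌊⌋⁻

  -- The Cantor cube.

  ListAgree : ∀ {ℓ} {V : Set ℓ} → List V → (c c′ : V → Bool) → Set ℓ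
  ListAgree vs c c′ = ∀ {v} → v ∈ vs → c v ≡ c′ v

  -- Compactness of the Cantor cube 2^V, in terms of closed sets.
  cube-compact : ∀ {ℓ} {V K : Set ℓ} (Sat : K → (V → Bool) → Set ℓ) →
    (∀ k c → ¬ Sat k c → ∃[ vs ] (∀ c′ → ListAgree vs c c′ → ¬ Sat k c′)) →
    (∀ ks → ∃[ c ] (∀ {k} → k ∈ ks → Sat k c)) →
    ∃[ c ] ∀ k → Sat k c
  cube-compact {ℓ} {V} {K} Sat closed finite = c , λ k → ¬¬-elim λ ¬sat →
    -- A failure of `k` at `c` would be visible on a finite list `vs`, but the graph of `c` on `vs`
    -- is consistent, so some colouring agreeing with `c` there satisfies `k`.
    let vs , refutes = closed k c ¬sat
        c′ , c′-ext , c′-sat = consistent (graph vs) (Allₗ.map⁺ (Allₗ.universal c∈S vs)) (k ∷ [])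
    in refutes c′ (λ v∈ → sym (c′-ext (∈ₗ.∈-map⁺ _ v∈))) (c′-sat (here refl))
    where
    -- A list of pairs is a finite partial colouring; `Q` asks that it extend to a solution of any
    -- finitely many conditions.
    Q : List (V × Bool) → Set ℓ
    Q ws = ∀ ks → ∃[ c ] (∀ {v b} → (v , b) ∈ ws → c v ≡ b) × (∀ {k} → k ∈ ks → Sat k c)

    Q-anti : ∀ {xs ys} → xs ⊆ₗ ys → Q ys → Q xs
    Q-anti p q ks = let c , ext , sat = q ks in c , (λ i → ext (p i)) , sat

    Q-[] : Q []
    Q-[] ks = let c , sat = finite ks in c , (λ ()) , sat

    maximal = maximal-consistent Q Q-anti Q-[]
    S = proj₁ maximal
    consistent = proj₁ (proj₂ maximal)

    c : V → Bool
    c v = S (v , true)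

    -- If both values at `v` were refuted, one colouring `d` would extend both finite parts and
    -- satisfy both lists of conditions, and its own value at `v` would contradict one refutation.
    decided : ∀ v → ¬ (¬ (S (v , true) ≡ true) × ¬ (S (v , false) ≡ true))
    decided v (v⁺∉ , v⁻∉) =
      let ws₁ , ws₁∈ , ¬q₁ = proj₂ (proj₂ maximal) (v , true) v⁺∉
          ws₂ , ws₂∈ , ¬q₂ = proj₂ (proj₂ maximal) (v , false) v⁻∉
          ks₁ , none₁ = ¬∀⟶∃¬ ¬q₁
          ks₂ , none₂ = ¬∀⟶∃¬ ¬q₂
          d , d-ext , d-sat = consistent (ws₁ List.++ ws₂) (Allₗ.++⁺ ws₁∈ ws₂∈) (ks₁ List.++ ks₂)
          sat₁ = λ {k} (i : k ∈ ks₁) → d-sat (∈ₗ.∈-++⁺ˡ i)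
          sat₂ = λ {k} (i : k ∈ ks₂) → d-sat (∈ₗ.∈-++⁺ʳ ks₁ i)
      in contra d (d v) refl
           (λ e → none₁ (d , (λ { (here refl) → e ; (there i) → d-ext (∈ₗ.∈-++⁺ˡ i) }) , sat₁))
           (λ e → none₂ (d , (λ { (here refl) → e ; (there i) → d-ext (∈ₗ.∈-++⁺ʳ ws₁ i) }) , sat₂))
      where
      contra : ∀ d b → d v ≡ b → ¬ (d v ≡ true) → ¬ ¬ (d v ≡ false)
      contra d true  e ¬t ¬f = ¬t e
      contra d false e ¬t ¬f = ¬f e

    c∈S : ∀ v → S (v , c v) ≡ true
    c∈S v with S (v , true) in eq
    ... | true  = eq
    ... | false = ¬¬-elim λ v⁻∉ → decided v ((λ e → absurd (trans (sym eq) e)) , v⁻∉)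
      where
      absurd : ¬ (false ≡ true)
      absurd ()

    graph : List V → List (V × Bool)
    graph = List.map λ v → v , c v

  -- Generated substructures, homogeneity and the age.

  module _ {ℓ} {L : Language ℓ} {M : Structure L} where

    -- The double negation makes membership proof-irrelevant.
    gen : ∀ {n} → Vec ∣ M ∣ n → Substructure M
    gen a = record
      { Member     = λ x → ¬ ¬ (∃[ t ] eval M a t ≡ x)
      ; irrelevant = λ p q → ext λ k → ⊥-elim (p k)
      ; closed     = λ f xs∈ k → let ts , eq = terms xs∈ in k (app f ts , cong (fun M f) eq)
      }
      where
      terms : ∀ {k} {xs : Vec ∣ M ∣ k} → All (λ x → ¬ ¬ (∃[ t ] eval M a t ≡ x)) xs →
              ∃[ ts ] evals M a ts ≡ xs
      terms []       = [] , refl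
      terms (p ∷ ps) = let t , eq = ¬¬-elim p ; ts , eqs = terms ps in
        t ∷ ts , cong₂ _∷_ eq eqs

    gen-fg : ∀ {n} (a : Vec ∣ M ∣ n) → FinitelyGenerated (gen a)
    gen-fg a = _ , a , ¬¬-elim , λ p k → k p

    gen-lookup : ∀ {n} (a : Vec ∣ M ∣ n) i → Member (gen a) (lookup a i)
    gen-lookup a i k = k (var i , refl)

    gen-++ˡ : ∀ {m n} (a : Vec ∣ M ∣ m) (b : Vec ∣ M ∣ n) i → Member (gen (a ++ b)) (lookup a i)
    gen-++ˡ a b i = subst (Member (gen (a ++ b))) (lookup-++ˡ a b i) (gen-lookup (a ++ b) (i ↑ˡ _))

    gen-++ʳ : ∀ {m n} (a : Vec ∣ M ∣ m) (b : Vec ∣ M ∣ n) i → Member (gen (a ++ b)) (lookup b i)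
    gen-++ʳ a b i = subst (Member (gen (a ++ b))) (lookup-++ʳ a b i) (gen-lookup (a ++ b) (_ ↑ʳ i))

    gen-age : ∀ {n} (a : Vec ∣ M ∣ n) → Age M ⟪ gen a ⟫
    gen-age a = gen a , gen-fg a , ≅-refl

    module _ {n} (a : Vec ∣ M ∣ n) where
      term : (x : ∣ ⟪ gen a ⟫ ∣) → Term L n
      term (x , p) = proj₁ (¬¬-elim p)

      eval-term : ∀ x → eval M a (term x) ≡ proj₁ x
      eval-term (x , p) = proj₂ (¬¬-elim p)

      evals-term : ∀ {k} (xs : Vec ∣ ⟪ gen a ⟫ ∣ k) → evals M a (map term xs) ≡ map proj₁ xs
      evals-term []       = refl
      evals-term (x ∷ xs) = cong₂ _∷_ (eval-term x) (evals-term xs)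

    gen-map : ∀ {n} (a b : Vec ∣ M ∣ n) → ∣ ⟪ gen a ⟫ ∣ → ∣ ⟪ gen b ⟫ ∣
    gen-map a b x = eval M b (term a x) , λ k → k (term a x , refl)

    -- Equality of the chosen term with `t` is a formula true of `a`, hence of `b`; so the choice of
    -- term does not affect the value.
    gen-map-eval : ∀ {n} (a b : Vec ∣ M ∣ n) → (∀ φ → Holds M a φ → Holds M b φ) →
                   ∀ x t → eval M a t ≡ proj₁ x → proj₁ (gen-map a b x) ≡ eval M b t
    gen-map-eval a b a⊆b x t eq = a⊆b (term a x ≐ₜ t) (trans (eval-term a x) (sym eq))

    gen-map-inverse : ∀ {n} (a b : Vec ∣ M ∣ n) → (∀ φ → Holds M a φ → Holds M b φ) →
                      ∀ y → gen-map a b (gen-map b a y) ≡ y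
    gen-map-inverse a b a⊆b y = member-≡ (gen b)
      (trans (gen-map-eval a b a⊆b (gen-map b a y) (term b y) refl)
             (eval-term b y))

    gen-≅ : ∀ {n} (a b : Vec ∣ M ∣ n) → qftp M b ≐ qftp M a → ⟪ gen a ⟫ ≅ ⟪ gen b ⟫
    gen-≅ a b (b⊆a , a⊆b) = record
      { bijection = mk↔ₛ′ to (gen-map b a)
          (gen-map-inverse a b λ φ → a⊆b {φ}) (gen-map-inverse b a λ φ → b⊆a {φ})
      ; to-fun = λ f xs → member-≡ (gen b)
          (trans (gen-map-eval a b (λ φ → a⊆b {φ}) _ (app f (map tm xs))
                   (cong (fun M f) (evals-term a xs)))
                 (cong (fun M f) (values-to xs)))
      ; to-rel = λ R xs → mk⇔
          (λ p → subst (rel M R) (values-to xs)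
             (a⊆b {atom R (map tm xs)} (subst (rel M R) (sym (evals-term a xs)) p)))
          (λ p → subst (rel M R) (evals-term a xs)
             (b⊆a {atom R (map tm xs)} (subst (rel M R) (sym (values-to xs)) p)))
      }
      where
      tm = term a
      to = gen-map a b
      values-to : ∀ {k} (xs : Vec ∣ ⟪ gen a ⟫ ∣ k) →
                  evals M b (map tm xs) ≡ map proj₁ (map to xs)
      values-to []       = refl
      values-to (x ∷ xs) = cong (_ ∷_) (values-to xs)

    -- The form in which ultrahomogeneity is used: equal types give an isomorphism of generated
    -- substructures matching the generators, and it extends to an automorphism.
    homogeneous : Ultrahomogeneous M → ∀ {n} {a b : Vec ∣ M ∣ n} → qftp M b ≐ qftp M a →
                  Σ (M ≅ M) λ g → map (_≅_.to g) a ≡ b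
    homogeneous uh {a = a} {b} b≐a = g , lookup-injective λ i →
      trans (lookup-map i (_≅_.to g) a)
        (trans (g-ext (lookup a i , gen-lookup a i))
               (gen-map-eval a b (λ φ → proj₂ b≐a {φ})
                 (lookup a i , gen-lookup a i) (var i) refl))
      where
      extension = uh (gen a) (gen b) (gen-fg a) (gen-fg b) (gen-≅ a b b≐a)
      g = proj₁ extension
      g-ext = proj₂ extension

    -- The images of the generators of `N` generate its image in `M`. The inverse isomorphism
    -- evaluates in `N` the term that names an element of the image.
    age-intro : ∀ {N : Structure L} → Embedding N M → Generated N → Age M N
    age-intro {N} e (n , b , gens) = gen (map to b) , gen-fg (map to b) , record
      { bijection = mk↔ₛ′ r.to (λ y → eval N b (term (map to b) y))
          (λ y → member-≡ (gen (map to b))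
            (trans (eval-map e b (term (map to b) y)) (eval-term (map to b) y)))
          (λ x → injective
            (trans (eval-map e b (term (map to b) (r.to x))) (eval-term (map to b) (r.to x))))
      ; to-fun    = r.to-fun
      ; to-rel    = r.to-rel
      }
      where
      open Embedding e
      image-member : ∀ x → Member (gen (map to b)) (to x)
      image-member x k = let t , eq = gens x in
        k (t , trans (sym (eval-map e b t)) (cong to eq))
      module r = Embedding (restrict e (gen (map to b)) image-member)

    age-HP : HP (Age M)
    age-HP N∈ T fg = age-intro (proj₁ (age-embeds N∈) ∘ₑ inclusion T)
      (generated (inclusion T) T fg proj₂ (λ m → (_ , m) , refl))

    -- Both structures embed in `M`, and the images of their generators together generate a common
    -- extension.
    age-JEP : JEP (Age M)
    age-JEP {N₁} {N₂} N₁∈ N₂∈ = ⟪ gen c ⟫ , gen-age c ,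
      into e₁ b₁ gens₁ (gen-++ˡ (map _ b₁) _) ,
      into e₂ b₂ gens₂ (gen-++ʳ (map _ b₁) _)
      where
      e₁ = proj₁ (age-embeds N₁∈)
      e₂ = proj₁ (age-embeds N₂∈)
      b₁ = proj₁ (proj₂ (proj₂ (age-embeds N₁∈)))
      b₂ = proj₁ (proj₂ (proj₂ (age-embeds N₂∈)))
      gens₁ = proj₂ (proj₂ (proj₂ (age-embeds N₁∈)))
      gens₂ = proj₂ (proj₂ (proj₂ (age-embeds N₂∈)))
      c = map (Embedding.to e₁) b₁ ++ map (Embedding.to e₂) b₂
      into : ∀ {N n} (e : Embedding N M) (b : Vec ∣ N ∣ n) → (∀ x → ∃[ t ] eval N b t ≡ x) →
             (∀ i → Member (gen c) (lookup (map (Embedding.to e) b) i)) → Embedding N ⟪ gen c ⟫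
      into e b gens b∈ = restrict e (gen c) λ x → let t , eq = gens x in
        subst (Member (gen c)) (trans (sym (eval-map e b t)) (cong (Embedding.to e) eq))
          (eval-member (gen c) (map (Embedding.to e) b) b∈ t)

    -- The Ramsey property inside `M` and its equivalence with f-ERP.

    RamseyIn : Set ℓ
    RamseyIn = ∀ {m n} (A : Vec ∣ M ∣ m) (B : Vec ∣ M ∣ n) →
      ∃[ k ] Σ (Vec ∣ M ∣ k) λ C → Arrow {M = M} {M} (_∈ᵥ C) B A

    -- Both tuples live in the substructure generated by `A ++ B`, a member of the age; the finite
    -- set found for it is then embedded in `M`.
    f-ERP⇒RamseyIn : f-ERP (Age M) → RamseyIn
    f-ERP⇒RamseyIn erp A B =
      let A₀ , eqA = lift-members S A (gen-++ˡ A B)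
          B₀ , eqB = lift-members S B (gen-++ʳ A B)
          N , N∈ , k , C , arrow = erp (gen-age (A ++ B)) A₀ B₀
          e = proj₁ (age-embeds N∈)
      in k , map (Embedding.to e) C ,
         arrow-push e A₀ B₀ C A B (same A₀ eqA) (same B₀ eqB) arrow
      where
      S = gen (A ++ B)
      same : ∀ {n} {D : Vec ∣ M ∣ n} D₀ → map proj₁ D₀ ≡ D → qftp M D ≐ qftp ⟪ S ⟫ D₀
      same D₀ refl = qftp-map (inclusion S) D₀

    RamseyIn⇒f-ERP : RamseyIn → f-ERP (Age M)
    RamseyIn⇒f-ERP ramsey {M₀} M₀∈ A B =
      let k , C , arrow = ramsey (map to A) (map to B)
          C₀ , eqC = lift-members (gen C) C (gen-lookup C)
      in ⟪ gen C ⟫ , gen-age C , k , C₀ ,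
         arrow-pull (inclusion (gen C)) A B C₀ (map to A) (map to B) (qftp-map e A) (qftp-map e B)
           (subst (λ D → Arrow {M = M} {M} (_∈ᵥ D) (map to B) (map to A)) (sym eqC) arrow)
      where
      e = proj₁ (age-embeds M₀∈)
      open Embedding e using (to)

  -- From the Ramsey property to fixed points.

  module _ {ℓ} {L : Language ℓ} (M : Structure L) (uh : Ultrahomogeneous M) where

    open _≅_ using (to; from; strictlyInverseˡ; strictlyInverseʳ)

    Colouring : Set ℓ
    Colouring = ∃[ m ] Vec ∣ M ∣ m × (Vec ∣ M ∣ m → Bool)

    -- Induction on the list. `C` is Ramsey for the first colouring, and `h` makes the others
    -- constant on `h C`. A copy of `B` in `C` on which `χ ∘ h` is constant has the form `g B` by
    -- homogeneity, and `h g B` stays inside `h C`.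
    simultaneous : RamseyIn {M = M} → (χs : List Colouring) → ∀ {n} (B : Vec ∣ M ∣ n) →
      Σ (M ≅ M) λ h → ∀ {m A χ} → (m , A , χ) ∈ χs → ConstantOn M A χ (map (to h) B)
    simultaneous ramsey [] B = ≅-refl , λ ()
    simultaneous ramsey ((m , A , χ) ∷ χs) B = ≅-trans g h , λ
      { (here refl) v v′ qv qv′ v⊆ v′⊆ →
          trans (sym (cong χ (to-from-map h v))) (trans
            (proj₂ (arrow χ∘h)
              (copy v qv (∈-map-to⁻ h v (e⇐ v v⊆)))
              (copy v′ qv′ (∈-map-to⁻ h v′ (e⇐ v′ v′⊆)))
              (∈-map-to⁻ h v (e⇐ v v⊆)) (∈-map-to⁻ h v′ (e⇐ v′ v′⊆)))
            (cong χ (to-from-map h v′)))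
      ; (there i) v v′ qv qv′ v⊆ v′⊆ → constant i v v′ qv qv′ (C⇐ v v⊆) (C⇐ v′ v′⊆)
      }
      where
      C = proj₁ (proj₂ (ramsey A B))
      arrow = proj₂ (proj₂ (ramsey A B))
      h = proj₁ (simultaneous ramsey χs C)
      constant = proj₂ (simultaneous ramsey χs C)
      χ∘h : Func (copies {M = M} {M} A (_∈ᵥ C)) (≡.setoid Bool)
      χ∘h = record { to = χ ∘ map (to h) ∘ values ; cong = cong (χ ∘ map (to h)) }
      e = proj₁ (arrow χ∘h)
      extension = homogeneous uh {a = B} {values e} (Copy.sameQF e)
      g = proj₁ extension

      hgB≡ : map (to (≅-trans g h)) B ≡ map (to h) (values e)
      hgB≡ = trans (map-∘ (to h) (to g) B) (cong (map (to h)) (proj₂ extension))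

      e⇐ : ∀ {k} (v : Vec ∣ M ∣ k) → (_∈ᵥ v) ⊆ (_∈ᵥ map (to (≅-trans g h)) B) →
           (_∈ᵥ v) ⊆ (_∈ᵥ map (to h) (values e))
      e⇐ v v⊆ x∈ = subst (_ ∈ᵥ_) hgB≡ (v⊆ x∈)

      e⊆C : (_∈ᵥ values e) ⊆ (_∈ᵥ C)
      e⊆C = All.lookup (Copy.inside e)

      C⇐ : ∀ {k} (v : Vec ∣ M ∣ k) → (_∈ᵥ v) ⊆ (_∈ᵥ map (to (≅-trans g h)) B) →
           (_∈ᵥ v) ⊆ (_∈ᵥ map (to h) C)
      C⇐ v v⊆ x∈ with z , refl , z∈ ← ∈-map⁻ {f = to h} (values e) (e⇐ v v⊆ x∈) =
        ∈-map⁺ (to h) (e⊆C z∈)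

      copy : (v : Vec ∣ M ∣ m) → qftp M v ≐ qftp M A → (_∈ᵥ map (from h) v) ⊆ (_∈ᵥ values e) →
             Copy {M = M} {M} A (_∈ᵥ C)
      copy v qv sub = record
        { values = map (from h) v
        ; inside = lookup⁻ λ i → e⊆C (sub (∈-lookup i _))
        ; sameQF = ≐-trans (qftp-aut (≅-sym h) v) qv
        }

    module _ {X : Setoid ℓ ℓ} (τ : Topology X) (α : ContinuousAction (Aut M) τ) where
      open Setoid X using (Carrier; _≈_) renaming (sym to ≈-sym; trans to ≈-trans; refl to ≈-refl)
      open ContinuousAction α
      private module τ = Topology τ

      record Displaced (x : Carrier) : Set (Level.suc ℓ) where
        field
          g        : M ≅ M
          W V      : Pred Carrier ℓ
          W-open   : τ.Open W
          V-open   : τ.Open V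
          x∈V      : V x
          disjoint : ∀ {z} → W z → ¬ W (g · z)
          arity    : ℕ
          tuple    : Vec ∣ M ∣ arity
          V⇒W      : ∀ h → AgreeOn M tuple ≅-refl h → ∀ {z} → V z → W (h · z)

      displaced : Hausdorff τ → ∀ x g → ¬ (g · x ≈ x) → Displaced x
      displaced hausdorff x g gx≉x =
        let U , U′ , oU , oU′ , x∈U , gx∈U′ , disj = hausdorff x (g · x) (gx≉x ∘ ≈-sym)
            -- Continuity at `(g , x)`: `g` carries `N` into `U′`, which is disjoint from `U`.
            _ , N , _ , oN , g∈ , x∈N , s = proj₂ (continuous oU′) g x gx∈U′
            oW = τ.Open-∩ oU oN
            -- Continuity at the identity and `x`: automorphisms near the identity, as measured by a
            -- tuple, move `V` into `W`.
            _ , V , oE , oV , ε∈E , x∈V , t =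
              proj₂ (continuous oW) ≅-refl x (τ.Open-resp oW (≈-sym (identity x)) (x∈U , x∈N))
            arity , a , near = lower oE ≅-refl ε∈E
        in record
          { g = g ; W = U ∩ N ; V = V ; W-open = oW ; V-open = oV ; x∈V = x∈V
          ; disjoint = λ { (_ , z∈N) (gz∈U , _) → disj _ (gz∈U , s g _ g∈ z∈N) }
          ; arity = arity ; tuple = a
          ; V⇒W = λ h fix z∈V → t h _ (near h fix) z∈V
          }

      module _ (compact : Compact τ) (x₀ : Carrier) (ramsey : RamseyIn {M = M})
               (D : ∀ x → Displaced x) where
        private module D x = Displaced (D x)

        -- Whether this holds depends on g only up to the stabiliser of the tuple,
        -- hence not at all if V x is relaxed to W x.
        colour : ∀ x → Vec ∣ M ∣ (D.arity x) → Bool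
        colour x v = ⌊ (Σ (M ≅ M) λ g → map (to g) (D.tuple x) ≡ v × D.V x (≅-sym g · x₀)) ⌋

        all-displaced⇒⊥ : ⊥
        all-displaced⇒⊥ = D.disjoint x y∈W gy∈W
          where
          cover = compact D.V D.V-open λ x → x , D.x∈V x
          xs = proj₁ cover

          relevant : Carrier → List ∣ M ∣
          relevant x = toList (D.tuple x) List.++ toList (map (from (D.g x)) (D.tuple x))

          -- `h` must be found before it is known which `V` contains `h⁻¹ x₀`, so `B` collects the
          -- tuples `a` and `g⁻¹ a` for the whole finite cover.
          B = fromList (List.concatMap relevant xs)
          common = simultaneous ramsey (List.map (λ x → _ , D.tuple x , colour x) xs) B
          h = proj₁ common
          y = ≅-sym h · x₀
          found = find (proj₂ cover y)
          x = proj₁ found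
          x∈xs = proj₁ (proj₂ found)
          g = D.g x
          a = D.tuple x

          y∈W : D.W x y
          y∈W = τ.Open-resp (D.W-open x) (identity y)
                  (D.V⇒W x ≅-refl (λ _ → refl) (proj₂ (proj₂ found)))

          inB : ∀ {z} → z ∈ relevant x → to h z ∈ᵥ map (to h) B
          inB z∈ = ∈-map⁺ (to h) (∈-fromList⁺ (∈ₗ.∈-concatMap⁺ relevant (lose x∈xs z∈)))

          sub : ∀ {k} (v : Vec ∣ M ∣ k) → (∀ {z} → z ∈ᵥ v → z ∈ relevant x) →
                (_∈ᵥ map (to h) v) ⊆ (_∈ᵥ map (to h) B)
          sub v v⊆ z∈ with _ , refl , i ← ∈-map⁻ {f = to h} v z∈ = inB (v⊆ i)

          a′ = map (from g) a

          same-colour : colour x (map (to h) a) ≡ colour x (map (to h) a′)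
          same-colour = proj₂ common (∈ₗ.∈-map⁺ (λ x → _ , D.tuple x , colour x) x∈xs) _ _
            (qftp-aut h a) (≐-trans (qftp-aut h a′) (qftp-aut (≅-sym g) a))
            (sub a (∈ₗ.∈-++⁺ˡ ∘ ∈-toList⁺)) (sub a′ (∈ₗ.∈-++⁺ʳ (toList a) ∘ ∈-toList⁺))

          -- `h` itself gives `h a` the colour `true`; equality of colours then provides `k` for the
          -- tuple `h g⁻¹ a`.
          witness : Σ (M ≅ M) λ k → map (to k) a ≡ map (to h) a′ × D.V x (≅-sym k · x₀)
          witness = ⌊⌋⁻ (trans (sym same-colour) (⌊⌋⁺ (h , refl , proj₂ (proj₂ found))))
          k = proj₁ witness
          -- s = g h⁻¹ k fixes a since k a = h g⁻¹ a.
          s = ≅-trans k (≅-trans (≅-sym h) g)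

          s-fixes : AgreeOn M a ≅-refl s
          s-fixes {z} z∈ = sym (trans
            (cong (to g ∘ from h)
              (map-≡⇒≡ a (trans (proj₁ (proj₂ witness)) (sym (map-∘ (to h) (from g) a))) z∈))
            (trans (cong (to g) (strictlyInverseʳ h (from g z))) (strictlyInverseˡ g z)))

          -- `g y = g h⁻¹ x₀ = s (k⁻¹ x₀)`, where `k⁻¹ x₀` lies in `V` and `s` fixes `a`.
          gy∈W : D.W x (g · y)
          gy∈W = τ.Open-resp (D.W-open x)
            (≈-trans (≈-sym (compatible s (≅-sym k) x₀))
              (≈-trans
                (Func.cong act ((λ z → cong (to g ∘ from h) (strictlyInverseˡ k z)) , ≈-refl))
                (compatible g (≅-sym h) x₀)))
            (D.V⇒W x s s-fixes (proj₂ (proj₂ witness)))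

    RamseyIn⇒extremelyAmenable : RamseyIn {M = M} → ExtremelyAmenable (Aut M)
    RamseyIn⇒extremelyAmenable ramsey X τ x₀ compact hausdorff α = ¬¬-elim λ none →
      all-displaced⇒⊥ τ α compact x₀ ramsey λ x →
        let g , moves = ¬∀⟶∃¬ λ fixed → none (x , fixed) in displaced τ α hausdorff x g moves

    -- From fixed points to the Ramsey property.

    module _ {m n} (A : Vec ∣ M ∣ m) (B : Vec ∣ M ∣ n) where

      CopyOfB : Set ℓ
      CopyOfB = Σ (Vec ∣ M ∣ n) λ e → qftp M e ≐ qftp M B

      Bad : (Vec ∣ M ∣ m → Bool) → Set ℓ
      Bad c = ((e , _) : CopyOfB) → ¬ ConstantOn M A c e

      -- Constancy on `e` involves only the finitely many `m`-tuples with entries in `e`.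
      nonconstant-closed : (e : Vec ∣ M ∣ n) → ∀ c → ¬ ¬ ConstantOn M A c e →
        ∃[ vs ] (∀ c′ → ListAgree vs c c′ → ¬ ¬ ConstantOn M A c′ e)
      nonconstant-closed e c ¬¬con = tuplesOver (toList e) m , λ c′ agree k →
        k λ v v′ qv qv′ v⊆ v′⊆ →
          trans (sym (agree (∈-tuplesOver v (∈-toList⁺ ∘ v⊆))))
            (trans (¬¬-elim ¬¬con v v′ qv qv′ v⊆ v′⊆) (agree (∈-tuplesOver v′ (∈-toList⁺ ∘ v′⊆))))

      -- Finitely many copies of `B` lie in a finite set `C`; as the arrow fails for `C`, one
      -- colouring is constant on none of them. Compactness extends this to all copies at once.
      bad-exists : ¬ (∃[ k ] Σ (Vec ∣ M ∣ k) λ C → Arrow {M = M} {M} (_∈ᵥ C) B A) → ∃ Bad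
      bad-exists none = cube-compact (λ (e , _) c → ¬ ConstantOn M A c e)
        (nonconstant-closed ∘ proj₁) finite
        where
        finite : (ks : List CopyOfB) → ∃[ c ] (∀ {k} → k ∈ ks → ¬ ConstantOn M A c (proj₁ k))
        finite ks = c , λ { {e , q} e∈ constant → proj₂ counterexample
            ( record { values = e
                     ; inside = lookup⁻ λ i → ∈-fromList⁺
                         (∈ₗ.∈-concatMap⁺ (toList ∘ proj₁) (lose e∈ (∈-toList⁺ (∈-lookup i e))))
                     ; sameQF = q }
            , λ f f′ f⊆ f′⊆ → trans (sym (c-values f)) (trans
                (constant (values f) (values f′) (Copy.sameQF f) (Copy.sameQF f′) f⊆ f′⊆)
                (c-values f′))) }
          where
          C = fromList (List.concatMap (toList ∘ proj₁) ks)
          counterexample = ¬∀⟶∃¬ λ arrow → none (_ , C , arrow)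
          χ = proj₁ counterexample

          -- The default `false` is harmless: constancy on a copy of `B` inside `C` only inspects
          -- copies of `A` inside `C`.
          c : Vec ∣ M ∣ m → Bool
          c v with em {P = Σ (Copy {M = M} {M} A (_∈ᵥ C)) λ f → values f ≡ v}
          ... | yes (f , _) = Func.to χ f
          ... | no _        = false

          c-values : ∀ f → c (values f) ≡ Func.to χ f
          c-values f with em {P = Σ (Copy {M = M} {M} A (_∈ᵥ C)) λ f′ → values f′ ≡ values f}
          ... | yes (f′ , eq) = Func.cong χ eq
          ... | no ¬f         = ⊥-elim (¬f (f , refl))

      -- The compact space of bad colourings and its action.

      badSetoid : Setoid ℓ ℓ
      badSetoid = record
        { Carrier       = ∃ Bad
        ; _≈_           = λ x y → ∀ v → proj₁ x v ≡ proj₁ y v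
        ; isEquivalence = record
          { refl  = λ _ → refl
          ; sym   = λ p v → sym (p v)
          ; trans = λ p q v → trans (p v) (q v)
          }
        }

      -- The subspace topology of the cube: basic neighbourhoods prescribe the colours of finitely
      -- many tuples.
      badTopology : Topology badSetoid
      badTopology = record
        { Open      = λ U → Lift (Level.suc ℓ)
            (∀ x → U x → ∃[ vs ] (∀ y → ListAgree vs (proj₁ x) (proj₁ y) → U y))
        ; Open-ext  = λ { (U⊆V , V⊆U) (lift o) → lift λ x x∈ →
            let vs , p = o x (V⊆U x∈) in vs , λ y agree → U⊆V (p y agree) }
        ; Open-resp = λ { (lift o) {x} {y} x≈y x∈ → proj₂ (o x x∈) y (λ _ → x≈y _) }
        ; Open-⊤    = lift λ _ _ → [] , _
        ; Open-∩    = λ { (lift o₁) (lift o₂) → lift λ { x (x∈₁ , x∈₂) →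
            let vs₁ , p₁ = o₁ x x∈₁
                vs₂ , p₂ = o₂ x x∈₂
            in vs₁ List.++ vs₂ , λ y agree →
              p₁ y (agree ∘ ∈ₗ.∈-++⁺ˡ) , p₂ y (agree ∘ ∈ₗ.∈-++⁺ʳ vs₁) } }
        ; Open-⋃    = λ U o → lift λ { x (i , x∈) →
            let vs , p = lower (o i) x x∈ in vs , λ y agree → i , p y agree }
        }

      agreement-open : ∀ vs c → Open badTopology (λ y → ListAgree vs c (proj₁ y))
      agreement-open vs c = lift λ x c-x → vs , λ y x-y i → trans (c-x i) (x-y i)

      bad-hausdorff : Hausdorff badTopology
      bad-hausdorff x y x≉y =
        let v , differ = ¬∀⟶∃¬ x≉y in
        _ , _ , agreement-open (v ∷ []) (proj₁ x) , agreement-open (v ∷ []) (proj₁ y) ,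
        (λ _ → refl) , (λ _ → refl) ,
        λ { z (x-z , y-z) → differ (trans (x-z (here refl)) (sym (y-z (here refl)))) }

      -- Badness and avoidance of each `U i` are closed conditions on the cube, finitely satisfiable
      -- if there is no finite subcover. As `U i` is defined only on bad colourings, avoidance by an
      -- arbitrary `c` is expressed through its neighbourhoods.
      bad-compact : Compact badTopology
      bad-compact {I} U U-open covers = ¬¬-elim λ no-subcover →
        let c , sat = cube-compact Sat closed (finite no-subcover)
            x = c , λ e → sat (inj₁ e)
            i , x∈U = covers x
        in sat (inj₂ i) (lower (U-open i) x x∈U)
        where
        Sat : CopyOfB ⊎ I → (Vec ∣ M ∣ m → Bool) → Set ℓ
        Sat (inj₁ (e , _)) c = ¬ ConstantOn M A c e
        Sat (inj₂ i)       c = ¬ (∃[ vs ] (∀ y → ListAgree vs c (proj₁ y) → U i y))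

        closed : ∀ k c → ¬ Sat k c → ∃[ vs ] (∀ c′ → ListAgree vs c c′ → ¬ Sat k c′)
        closed (inj₁ (e , _)) c ¬sat = nonconstant-closed e c ¬sat
        closed (inj₂ i)       c ¬sat = let vs , p = ¬¬-elim ¬sat in
          vs , λ c′ c-c′ sat → sat (vs , λ y c′-y → p y λ v∈ → trans (c-c′ v∈) (c′-y v∈))

        index : CopyOfB ⊎ I → List I
        index = [ const [] , List.[_] ]

        finite : ¬ _ → (ks : List (CopyOfB ⊎ I)) → ∃[ c ] (∀ {k} → k ∈ ks → Sat k c)
        finite no-subcover ks =
          let x , x∉ = ¬∀⟶∃¬ λ covered → no-subcover (List.concatMap index ks , covered) in
          proj₁ x , λ
            { {inj₁ e} _ → proj₂ x e
            ; {inj₂ i} i∈ (vs , p) →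
                x∉ (lose (∈ₗ.∈-concatMap⁺ index (lose i∈ (here refl))) (p x λ _ → refl)) }

      badAction : ContinuousAction (Aut M) badTopology
      badAction = record
        { act        = record
          { to   = λ (g , x) → translate g x
          ; cong = λ { {g , c , _} {g′ , c′ , _} (g≈g′ , c≈c′) v → trans
              (cong c (map-cong (Group.⁻¹-cong (autGroup M) {g} {g′} g≈g′) v)) (c≈c′ _) }
          }
        ; identity   = λ (c , _) v → cong c (map-id v)
        ; compatible = λ g h (c , _) v → cong c (map-∘ (from h) (from g) v)
        ; continuous = λ {U} oU →
            (λ { {g , x@(c , _)} {g′ , x′@(c′ , _)} (g≈g′ , c≈c′) →
              Topology.Open-resp badTopology oU {translate g x} {translate g′ x′} λ v →
                trans (cong c (map-cong (Group.⁻¹-cong (autGroup M) {g} {g′} g≈g′) v)) (c≈c′ _) }) ,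
            λ g x gx∈U →
              let vs , p = lower oU (translate g x) gx∈U
                  -- If `h` agrees with `g` at the points `g⁻¹ z`, then `h⁻¹` agrees with `g⁻¹` at
                  -- the entries `z` of the tuples in `vs`.
                  points = map (from g) (fromList (List.concatMap toList vs))
              in AgreeOn M points g ,
                 (λ y → ListAgree (List.map (map (from g)) vs) (proj₁ x) (proj₁ y)) ,
                 lift (λ h g-h → _ , points , λ h′ h-h′ i → trans (g-h i) (h-h′ i)) ,
                 agreement-open _ _ , (λ _ → refl) , (λ _ → refl) ,
                 λ h y g-h x-y → p (translate h y) λ {v} v∈ → trans
                   (x-y (∈ₗ.∈-map⁺ _ v∈))
                   (cong (proj₁ y) (map-cong-∈ v λ {z} z∈ → trans
                     (sym (strictlyInverseʳ h (from g z)))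
                     (cong (from h) (trans
                       (sym (g-h (∈-map⁺ (from g)
                         (∈-fromList⁺ (∈ₗ.∈-concatMap⁺ toList (lose v∈ (∈-toList⁺ z∈)))))))
                       (strictlyInverseˡ g z)))))
        }
        where
        -- Were `c ∘ g⁻¹` constant on a copy `e` of `B`, `c` would be constant on the copy `g⁻¹ e`.
        translate : M ≅ M → ∃ Bad → ∃ Bad
        translate g (c , bad) = c ∘ map (from g) , λ (e , q) constant →
          bad (map (from g) e , ≐-trans (qftp-aut (≅-sym g) e) q) λ v v′ qv qv′ v⊆ v′⊆ →
            trans (sym (cong c (from-to-map g v))) (trans
              (constant _ _ (≐-trans (qftp-aut g v) qv) (≐-trans (qftp-aut g v′) qv′)
                (∈-map-to⁻ (≅-sym g) v v⊆) (∈-map-to⁻ (≅-sym g) v′ v′⊆))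
              (cong c (from-to-map g v′)))

      -- By homogeneity the copies of `A` form one orbit, and `B` is itself among the copies on
      -- which a bad colouring is not constant.
      no-bad-fixed : ((c , _) : ∃ Bad) → ¬ (∀ (g : M ≅ M) v → c (map (from g) v) ≡ c v)
      no-bad-fixed (c , bad) fixed = bad (B , ≐-refl) λ v v′ qv qv′ _ _ →
        trans (colour-A v qv) (sym (colour-A v′ qv′))
        where
        colour-A : ∀ v → qftp M v ≐ qftp M A → c v ≡ c A
        colour-A v qv with g , refl ← homogeneous uh {a = A} {v} qv =
          trans (sym (fixed g v)) (cong c (from-to-map g A))

    extremelyAmenable⇒RamseyIn : ExtremelyAmenable (Aut M) → RamseyIn {M = M}
    extremelyAmenable⇒RamseyIn ea A B = ¬¬-elim λ none →
      let x , fixed = ea (badSetoid A B) (badTopology A B) (bad-exists A B none)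
                        (bad-compact A B) (bad-hausdorff A B) (badAction A B)
      in no-bad-fixed A B x fixed

theorem3 : (∀ {a} → ExcludedMiddle a) →
    (∀ {a b} → Extensionality a b) →
    ∀ {ℓ} {L : Language ℓ} (M : Structure L) →
    Ultrahomogeneous M →
    ExtremelyAmenable (Aut M) ⇔ FinitaryRamseyClass (Age M)
theorem3 em ext M uh = mk⇔
  (λ amenable → (λ {N} → age-HP {M = M} {N}) , (λ {N} {N′} → age-JEP {M = M} {N} {N′}) ,
    λ {N} → RamseyIn⇒f-ERP (extremelyAmenable⇒RamseyIn M uh amenable) {N})
  (λ (_ , _ , erp) → RamseyIn⇒extremelyAmenable M uh (f-ERP⇒RamseyIn λ {N} → erp {N}))
  where open Classical em ext
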